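{- For every real matrix $A\in\mathbb{R}^{X\times Y}$ and every $\alpha>0$, $$\operatorname{Ldim}_\alpha(A)\le\frac{4\|A\|_{\gamma_2}^2}{\alpha^2}.$$
   Context: Factorization norm: for a real matrix $A:X\times Y\to\mathbb{R}$, $$\|A\|_{\gamma_2}:=\inf\Big\{\big(\sup_x\|u_x\|\big)\big(\sup_y\|v_y\|\big):A(x,y)=\langle u_x,v_y\rangle\text{ for some Hilbert space vectors }u_x,v_y\Big\}.$$ Weighted mistake tree: a weighted mistake tree of depth $d$ over $X$ is a complete binary tree of depth $d$ whose internal nodes $\nu$ are labelled by pairs $(x(\nu),w(\nu))\in X\times\mathbb{R}$. The matrix $A$ $\alpha$-shatters the tree if for every root-to-leaf path there is a column $y\in Y$ such that at each internal node $\nu$ on the path, $A(x(\nu),y)\ge w(\nu)+\alpha/2$ if the path turns left at $\nu$, and $A(x(\nu),y)\le w(\nu)-\alpha/2$ if the path turns right at $\nu$. The weighted Littlestone dimension $\operatorname{Ldim}_\alpha(A)$ is the largest depth of a weighted mistake tree that $A$ $\alpha$-shatters. -}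

module Defs where

open import Level using (Level; suc; _⊔_)
open import Algebra.Apartness.Bundles using (HeytingField; HeytingCommutativeRing)
open import Algebra.Bundles using (CommutativeRing)
open import Algebra.Definitions.RawMonoid using () renaming (_×_ to multiple)
open import Algebra.Module.Bundles using (Module)
open import Data.Maybe.Base using (map)
open import Data.Nat.Base as ℕ using (ℕ)
open import Data.Product.Base using (∃-syntax; _×_; _,_; proj₁; proj₂)
open import Data.Sum.Base using (_⊎_; inj₂)
open import Data.Unit.Polymorphic.Base using (⊤)
open import Data.Vec.Base using (Vec; []; _∷_)
open import Relation.Binary.Construct.Add.Supremum.NonStrict using (_≤⁺_)
open import Relation.Binary.Core using (Rel)
open import Relation.Binary.Structures using (IsStrictPartialOrder)
open import Relation.Nullary.Construct.Add.Supremum using (_⁺; [_])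
open import Relation.Nullary.Negation.Core using (¬_)

-- The field of real numbers, axiomatised as a Cauchy complete Archimedean
-- ordered field.  Classically this determines ℝ up to unique isomorphism.  The
-- axioms are phrased so that they also hold for the constructive Cauchy reals
-- (hence apartness, and x ≤ y as the negation of y < x).
record RealNumbers (ℓ : Level) : Set (suc ℓ) where
  infix 4 _<_ _≤_ _≤∞_
  field
    heytingField : HeytingField ℓ ℓ ℓ

  open HeytingField heytingField public using (heytingCommutativeRing; tight)
  open HeytingCommutativeRing heytingCommutativeRing public
    using (commutativeRing; _#_; #⇒invertible; invertible⇒#; #-irrefl; #-sym; #-cotrans)
  open CommutativeRing commutativeRing public renaming (Carrier to ℝ)

  fromℕ : ℕ → ℝ
  fromℕ n = multiple +-rawMonoid n 1#

  field
    _<_                  : Rel ℝ ℓ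
    isStrictPartialOrder : IsStrictPartialOrder _≈_ _<_
    #⇒<⊎>                : ∀ {x y} → x # y → x < y ⊎ y < x
    <⊎>⇒#                : ∀ {x y} → x < y ⊎ y < x → x # y
    0<1                  : 0# < 1#
    +-monoˡ-<            : ∀ {x y} z → x < y → x + z < y + z
    0<x*y                : ∀ {x y} → 0# < x → 0# < y → 0# < x * y
    archimedean          : ∀ x → ∃[ n ] x < fromℕ n
    -- f m - f n < ε for all large m and n bounds |f m - f n|, as m and n may
    -- be exchanged.
    complete             :
      ∀ (f : ℕ → ℝ) →
      (∀ ε → 0# < ε → ∃[ N ] (∀ m n → N ℕ.≤ m → N ℕ.≤ n → f m - f n < ε)) →
      ∃[ x ] (∀ ε → 0# < ε →
        ∃[ N ] (∀ n → N ℕ.≤ n → (f n - x < ε) × (x - f n < ε)))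

  open IsStrictPartialOrder isStrictPartialOrder public
    using (<-resp-≈)
    renaming (irrefl to <-irrefl; trans to <-trans)

  _≤_ : Rel ℝ ℓ
  x ≤ y = ¬ (y < x)

  pos⇒#0 : ∀ {x} → 0# < x → x # 0#
  pos⇒#0 0<x = <⊎>⇒# (inj₂ 0<x)

  0<fromℕ-suc : ∀ n → 0# < fromℕ (ℕ.suc n)
  0<fromℕ-suc ℕ.zero = proj₁ <-resp-≈ (sym (+-identityʳ 1#)) 0<1
  0<fromℕ-suc (ℕ.suc n) =
    <-trans 0<1
      (proj₁ <-resp-≈ (+-comm (fromℕ (ℕ.suc n)) 1#)
        (proj₂ <-resp-≈ (+-identityˡ 1#)
          (+-monoˡ-< 1# (0<fromℕ-suc n))))

  infixl 7 _/_[_]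
  _/_[_] : ∀ (x y : ℝ) → y # 0# → ℝ
  x / y [ y#0 ] = x * proj₁ (#⇒invertible y#0)

  _/2 : ℝ → ℝ
  x /2 = x / fromℕ 2 [ pos⇒#0 (0<fromℕ-suc 1) ]

  _≤∞_ : Rel (ℝ ⁺) ℓ
  _≤∞_ = _≤⁺_ _≤_

module _ {ℓ} (R : RealNumbers ℓ) where
  open RealNumbers R

  -- The norm is a field because a square root is not available as an operation
  -- on R; the two axioms about it determine it as √⟨ u , u ⟩.
  record HilbertSpace : Set (suc ℓ) where
    field
      space : Module commutativeRing ℓ ℓ

    open Module space public using (Carrierᴹ; _≈ᴹ_; _+ᴹ_; _*ₗ_; 0ᴹ; -ᴹ_; isModule)

    field
      ⟨_,_⟩       : Carrierᴹ → Carrierᴹ → ℝ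
      ⟨⟩-cong     : ∀ {u u′ v v′} → u ≈ᴹ u′ → v ≈ᴹ v′ → ⟨ u , v ⟩ ≈ ⟨ u′ , v′ ⟩
      ⟨⟩-sym      : ∀ u v → ⟨ u , v ⟩ ≈ ⟨ v , u ⟩
      ⟨⟩-+ˡ       : ∀ u v w → ⟨ u +ᴹ v , w ⟩ ≈ ⟨ u , w ⟩ + ⟨ v , w ⟩
      ⟨⟩-*ˡ       : ∀ r u v → ⟨ r *ₗ u , v ⟩ ≈ r * ⟨ u , v ⟩
      ⟨⟩-nonneg   : ∀ u → 0# ≤ ⟨ u , u ⟩
      ⟨⟩-definite : ∀ u → ⟨ u , u ⟩ ≈ 0# → u ≈ᴹ 0ᴹ

      ‖_‖         : Carrierᴹ → ℝ
      ‖‖-nonneg   : ∀ u → 0# ≤ ‖ u ‖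
      ‖‖-square   : ∀ u → ‖ u ‖ * ‖ u ‖ ≈ ⟨ u , u ⟩

      ‖‖-complete :
        ∀ (f : ℕ → Carrierᴹ) →
        (∀ ε → 0# < ε →
          ∃[ N ] (∀ m n → N ℕ.≤ m → N ℕ.≤ n → ‖ f m +ᴹ (-ᴹ f n) ‖ < ε)) →
        ∃[ u ] (∀ ε → 0# < ε →
          ∃[ N ] (∀ n → N ℕ.≤ n → ‖ f n +ᴹ (-ᴹ u) ‖ < ε))

  -- Supremum of a family of nonnegative reals, taken in [0,∞): the empty family
  -- has supremum 0.
  IsSup₀ : {I : Set ℓ} → (I → ℝ) → ℝ → Set ℓ
  IsSup₀ f s = (0# ≤ s)
             × (∀ i → f i ≤ s)
             × (∀ b → 0# ≤ b → (∀ i → f i ≤ b) → s ≤ b)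

  module _ {X Y : Set ℓ} (A : X → Y → ℝ) where

    -- Only factorizations with finite suprema are recorded: the others cost ∞
    -- and do not affect the infimum.
    record Factorization : Set (suc ℓ) where
      field
        H : HilbertSpace
      open HilbertSpace H
      field
        u       : X → Carrierᴹ
        v       : Y → Carrierᴹ
        factors : ∀ x y → A x y ≈ ⟨ u x , v y ⟩
        supᵘ    : ℝ
        supᵛ    : ℝ
        isSupᵘ  : IsSup₀ (λ x → ‖ u x ‖) supᵘ
        isSupᵛ  : IsSup₀ (λ y → ‖ v y ‖) supᵛ

      cost : ℝ
      cost = supᵘ * supᵛ

    -- γ = ‖A‖_γ₂, the infimum in ℝ ∪ {∞}; it is ∞ when A has no factorization
    -- of finite cost.
    IsFactorizationNorm : ℝ ⁺ → Set (suc ℓ)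
    IsFactorizationNorm γ =
      (∀ (F : Factorization) → γ ≤∞ [ Factorization.cost F ]) ×
      (∀ b → (∀ (F : Factorization) → b ≤∞ [ Factorization.cost F ]) → b ≤∞ γ)

  data MistakeTree (X : Set ℓ) : ℕ → Set ℓ where
    leaf : MistakeTree X ℕ.zero
    node : ∀ {d} (x : X) (w : ℝ) (l r : MistakeTree X d) → MistakeTree X (ℕ.suc d)

  data Direction : Set where
    left right : Direction

  module _ {X Y : Set ℓ} (A : X → Y → ℝ) (α : ℝ) where

    Realizes : ∀ {d} → MistakeTree X d → Vec Direction d → Y → Set ℓ
    Realizes leaf           []          y = ⊤
    Realizes (node x w l r) (left  ∷ p) y = (w + α /2 ≤ A x y) × Realizes l p y
    Realizes (node x w l r) (right ∷ p) y = (A x y ≤ w - α /2) × Realizes r p y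

    Shatters : ∀ {d} → MistakeTree X d → Set ℓ
    Shatters t = ∀ p → ∃[ y ] Realizes t p y

    -- L = Ldim_α(A), the supremum in ℕ ∪ {∞} of the depths of shattered trees:
    -- the largest such depth, or ∞ if there are shattered trees of arbitrarily
    -- large depth.
    IsLdim : ℕ ⁺ → Set ℓ
    IsLdim L =
      (∀ {d} (t : MistakeTree X d) → Shatters t → [ d ] ≤ℕ∞ L) ×
      (∀ b → (∀ {d} (t : MistakeTree X d) → Shatters t → [ d ] ≤ℕ∞ b) → L ≤ℕ∞ b)
      where
      _≤ℕ∞_ : Rel (ℕ ⁺) _
      _≤ℕ∞_ = _≤⁺_ ℕ._≤_

  fromℕ∞ : ℕ ⁺ → ℝ ⁺
  fromℕ∞ = map fromℕ

  -- 4γ²/α², which is ∞ for γ = ∞.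
  4γ²/α² : ∀ (γ : ℝ ⁺) (α : ℝ) → 0# < α → ℝ ⁺
  4γ²/α² γ α 0<α =
    map (λ g → fromℕ 4 * (g * g) / (α * α) [ pos⇒#0 (0<x*y 0<α 0<α) ]) γ

{-# OPTIONS --safe #-}
module Submission where

-- A perceptron argument.  Let h = α/2, ‖u x‖² ≤ a, ‖v y‖² ≤ c and m, k ≥ 0.
-- Descending a shattered tree, keep a vector s, and at a node (x , w) add m u x
-- and turn left if ⟨ s , u x ⟩ ≤ k w, or subtract m u x and turn right otherwise.
-- With this choice each step increases ⟨ s , s ⟩ - 2k Σ ± m w by at most m² a,
-- while realizability of the path by y gives ± A x y ≥ ± w + h.  As
-- 2k ⟨ s , v y ⟩ ≤ ⟨ s , s ⟩ + k² c, a tree of depth d forces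
-- 2 d h m k ≤ d m² a + k² c for all m and k, and the discriminant of this
-- quadratic form yields d h² ≤ a c.

open import Defs
open import Algebra.Module.Bundles using (Module)
import Algebra.Properties.Ring as RingProperties
import Algebra.Apartness.Properties.HeytingCommutativeRing as HeytingProperties
import Algebra.Solver.Ring.NaturalCoefficients.Default as SemiringSolver
open import Data.Empty using (⊥-elim)
open import Data.Nat.Base as ℕ using (ℕ)
import Data.Nat.Properties as ℕₚ
open import Data.Product.Base using (∃-syntax; _×_; _,_; proj₁; proj₂)
open import Data.Sum.Base using (_⊎_; inj₁; inj₂)
open import Data.Vec.Base using ([]; _∷_)
open import Relation.Binary.Construct.Add.Supremum.NonStrict using (_≤⁺_; [_]; _≤⊤⁺; [≤]-injective)
open import Relation.Nullary.Construct.Add.Supremum using (_⁺; [_]; ⊤⁺)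
open import Relation.Nullary.Decidable.Core using (yes; no; ¬¬-excluded-middle)
open import Relation.Nullary.Negation.Core using (¬_; contradiction)

-- Order and arithmetic in a constructive ordered field.

module OrderedField {ℓ} (R : RealNumbers ℓ) where
  open RealNumbers R
  open SemiringSolver commutativeSemiring
  open HeytingProperties heytingCommutativeRing using (x-0≈x; invertibleˡ⇒#)

  <-respʳ : ∀ {x y z} → y ≈ z → x < y → x < z
  <-respʳ = proj₁ <-resp-≈

  <-respˡ : ∀ {x y z} → x ≈ y → x < z → y < z
  <-respˡ = proj₂ <-resp-≈

  -- Stands in for trichotomy. Cotransitivity of `#` separates `y` from one end; if the direction is
  -- the unhelpful one, `y` lies outside the interval and transitivity with `x < z` gives the other
  -- alternative.
  <-cotrans : ∀ {x z} → x < z → ∀ y → x < y ⊎ y < z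
  <-cotrans x<z y with #-cotrans (<⊎>⇒# (inj₁ x<z)) y
  ... | inj₁ x#y with #⇒<⊎> x#y
  ...   | inj₁ x<y = inj₁ x<y
  ...   | inj₂ y<x = inj₂ (<-trans y<x x<z)
  <-cotrans x<z y | inj₂ y#z with #⇒<⊎> y#z
  ...   | inj₁ y<z = inj₂ y<z
  ...   | inj₂ z<y = inj₁ (<-trans x<z z<y)

  <⇒≤ : ∀ {x y} → x < y → x ≤ y
  <⇒≤ x<y y<x = <-irrefl refl (<-trans x<y y<x)

  ≤-resp : ∀ {x x′ y y′} → x ≈ x′ → y ≈ y′ → x ≤ y → x′ ≤ y′
  ≤-resp x≈x′ y≈y′ x≤y y′<x′ = x≤y (<-respˡ (sym y≈y′) (<-respʳ (sym x≈x′) y′<x′))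

  ≤-reflexive : ∀ {x y} → x ≈ y → x ≤ y
  ≤-reflexive x≈y y<x = <-irrefl (sym x≈y) y<x

  ≤-trans : ∀ {x y z} → x ≤ y → y ≤ z → x ≤ z
  ≤-trans {y = y} x≤y y≤z z<x with <-cotrans z<x y
  ... | inj₁ z<y = y≤z z<y
  ... | inj₂ y<x = x≤y y<x

  +-cancelʳ : ∀ x z → x + z - z ≈ x
  +-cancelʳ x z = trans (+-assoc x z (- z)) (trans (+-congˡ (-‿inverseʳ z)) (+-identityʳ x))

  +-cancelʳ-< : ∀ {x y} z → x + z < y + z → x < y
  +-cancelʳ-< {x} {y} z p = <-respˡ (+-cancelʳ x z) (<-respʳ (+-cancelʳ y z) (+-monoˡ-< (- z) p))

  +-cancelʳ-≤ : ∀ {x y} z → x + z ≤ y + z → x ≤ y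
  +-cancelʳ-≤ z p y<x = p (+-monoˡ-< z y<x)

  +-mono-≤ : ∀ {x y u v} → x ≤ y → u ≤ v → x + u ≤ y + v
  +-mono-≤ {x} {y} {u} {v} x≤y u≤v = ≤-trans
    (λ p → x≤y (+-cancelʳ-< u p))
    (≤-resp (+-comm u y) (+-comm v y) (λ p → u≤v (+-cancelʳ-< y p)))

  x+[y-x]≈y : ∀ x y → x + (y - x) ≈ y
  x+[y-x]≈y x y = trans (+-comm x (y - x))
    (trans (+-assoc y (- x) x) (trans (+-congˡ (-‿inverseˡ x)) (+-identityʳ y)))

  -- Trading an inequality for an equation with an explicit increment leaves identities without
  -- subtraction, which the commutative-semiring solver can settle.
  <⇒+ : ∀ {x y} → x < y → ∃[ δ ] 0# < δ × y ≈ x + δ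
  <⇒+ {x} {y} x<y =
    y - x , <-respˡ (-‿inverseʳ x) (+-monoˡ-< (- x) x<y) , sym (x+[y-x]≈y x y)

  ≤⇒+ : ∀ {x y} → x ≤ y → ∃[ p ] 0# ≤ p × y ≈ x + p
  ≤⇒+ {x} {y} x≤y =
    y - x
    , (λ q → x≤y (+-cancelʳ-< (- x) (<-respʳ (sym (-‿inverseʳ x)) q)))
    , sym (x+[y-x]≈y x y)

  +⇒≤ : ∀ {x y p} → 0# ≤ p → y ≈ x + p → x ≤ y
  +⇒≤ {x} 0≤p y≈x+p =
    ≤-resp (+-identityʳ x) (sym y≈x+p) (+-mono-≤ (≤-reflexive (refl {x})) 0≤p)

  +⇒< : ∀ {x y δ} → 0# < δ → y ≈ x + δ → x < y
  +⇒< {x} {y} {δ} 0<δ y≈x+δ =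
    <-respˡ (+-identityˡ x) (<-respʳ (trans (+-comm δ x) (sym y≈x+δ)) (+-monoˡ-< x 0<δ))

  0≤1 : 0# ≤ 1#
  0≤1 = <⇒≤ 0<1

  +-nonneg : ∀ {x y} → 0# ≤ x → 0# ≤ y → 0# ≤ x + y
  +-nonneg 0≤x 0≤y = ≤-resp (+-identityˡ 0#) refl (+-mono-≤ 0≤x 0≤y)

  -- Comparing 0 with the strict inequality `x < x + y` leaves only `0 < x + y`, since `x < 0` is
  -- excluded.
  +-nonneg-pos : ∀ {x y} → 0# ≤ x → 0# < y → 0# < x + y
  +-nonneg-pos {x} {y} 0≤x 0<y with <-cotrans (+⇒< {x} 0<y refl) 0#
  ... | inj₁ x<0 = contradiction x<0 0≤x
  ... | inj₂ 0<x+y = 0<x+y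

  nonneg∧≯0⇒≈0 : ∀ {x} → 0# ≤ x → ¬ 0# < x → x ≈ 0#
  nonneg∧≯0⇒≈0 {x} 0≤x x≯0 = proj₁ (tight x 0#) λ x#0 → helper (#⇒<⊎> x#0)
    where
    helper : ¬ (x < 0# ⊎ 0# < x)
    helper (inj₁ x<0) = 0≤x x<0
    helper (inj₂ 0<x) = x≯0 0<x

  -- The goal is a negation, so each factor may be assumed positive or not positive. By tightness a
  -- nonnegative factor that is not positive is 0, which makes the product 0.
  *-nonneg : ∀ {x y} → 0# ≤ x → 0# ≤ y → 0# ≤ x * y
  *-nonneg {x} {y} 0≤x 0≤y xy<0 = x≯0 λ 0<x → y≯0 λ 0<y → <⇒≤ (0<x*y 0<x 0<y) xy<0
    where
    x≯0 : ¬ ¬ 0# < x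
    x≯0 p = <-irrefl (trans (*-congʳ (nonneg∧≯0⇒≈0 0≤x p)) (zeroˡ y)) xy<0
    y≯0 : ¬ ¬ 0# < y
    y≯0 p = <-irrefl (trans (*-congˡ (nonneg∧≯0⇒≈0 0≤y p)) (zeroʳ x)) xy<0

  *-monoˡ-≤ : ∀ {x y z} → 0# ≤ z → x ≤ y → z * x ≤ z * y
  *-monoˡ-≤ {x} {y} {z} 0≤z x≤y =
    let p , 0≤p , y≈x+p = ≤⇒+ x≤y
    in +⇒≤ (*-nonneg 0≤z 0≤p) (trans (*-congˡ y≈x+p) (distribˡ z x p))

  *-mono-≤ : ∀ {x y u v} → 0# ≤ x → 0# ≤ v → x ≤ y → u ≤ v → x * u ≤ y * v
  *-mono-≤ {x} {y} {u} {v} 0≤x 0≤v x≤y u≤v = ≤-trans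
    (*-monoˡ-≤ 0≤x u≤v)
    (≤-resp (*-comm v x) (*-comm v y) (*-monoˡ-≤ 0≤v x≤y))

  x<y⇒x²<y² : ∀ {x y} → 0# ≤ x → x < y → x * x < y * y
  x<y⇒x²<y² {x} {y} 0≤x x<y =
    let δ , 0<δ , y≈x+δ = <⇒+ x<y
    in +⇒< (+-nonneg-pos (*-nonneg 0≤x (<⇒≤ (+-nonneg-pos (<⇒≤ 0<δ) 0<δ))) (0<x*y 0<δ 0<δ))
      (trans (*-cong y≈x+δ y≈x+δ)
        (solve 2 (λ x δ → (x :+ δ) :* (x :+ δ) := x :* x :+ (x :* (δ :+ δ) :+ δ :* δ)) refl x δ))

  -- Reciprocals, natural numbers and halves.

  reciprocal : ∀ {x} → x # 0# → ℝ
  reciprocal x#0 = proj₁ (#⇒invertible x#0)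

  reciprocal-inverseʳ : ∀ {x} (x#0 : x # 0#) → x * reciprocal x#0 ≈ 1#
  reciprocal-inverseʳ {x} x#0 =
    trans (*-congʳ (sym (x-0≈x x))) (proj₂ (proj₂ (#⇒invertible x#0)))

  -- The reciprocal is itself invertible, hence apart from 0; were it negative, 1 would be at most
  -- 0.
  reciprocal-pos : ∀ {x} (x#0 : x # 0#) → 0# < x → 0# < reciprocal x#0
  reciprocal-pos {x} x#0 0<x with #⇒<⊎> (invertibleˡ⇒# {reciprocal x#0} {0#}
    (x , trans (*-congˡ (x-0≈x _)) (reciprocal-inverseʳ x#0)))
  ... | inj₂ 0<i = 0<i
  ... | inj₁ i<0 =
    contradiction 0<1 (≤-resp (reciprocal-inverseʳ x#0) (zeroʳ x) (*-monoˡ-≤ (<⇒≤ 0<x) (<⇒≤ i<0)))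

  0≤fromℕ : ∀ n → 0# ≤ fromℕ n
  0≤fromℕ ℕ.zero = ≤-reflexive refl
  0≤fromℕ (ℕ.suc n) = <⇒≤ (0<fromℕ-suc n)

  fromℕ-mono-≤ : ∀ {m n} → m ℕ.≤ n → fromℕ m ≤ fromℕ n
  fromℕ-mono-≤ {n = n} ℕ.z≤n = 0≤fromℕ n
  fromℕ-mono-≤ (ℕ.s≤s m≤n) = +-mono-≤ (≤-reflexive (refl {1#})) (fromℕ-mono-≤ m≤n)

  x/2+x/2≈x : ∀ x → x /2 + x /2 ≈ x
  x/2+x/2≈x x =
    trans (solve 2 (λ x i → x :* i :+ x :* i := x :* ((con 1 :+ (con 1 :+ con 0)) :* i)) refl x i)
      (trans (*-congˡ (reciprocal-inverseʳ 2#0)) (*-identityʳ x))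
    where
    2#0 = pos⇒#0 (0<fromℕ-suc 1)
    i = reciprocal 2#0

  0≤x/2 : ∀ {x} → 0# ≤ x → 0# ≤ x /2
  0≤x/2 0≤x = *-nonneg 0≤x (<⇒≤ (reciprocal-pos _ (0<fromℕ-suc 1)))

  -- Quadratic inequalities.

  -- If δ = n h² - a c > 0, the form is negative at m = h (c + 1), k = a (c + 1) + δ.
  discriminant : ∀ {n a c h} → 0# ≤ a → 0# ≤ c → 0# ≤ h →
    (∀ m k → 0# ≤ m → 0# ≤ k → n * (h * m * k + h * m * k) ≤ n * (m * m * a) + k * k * c) →
    n * (h * h) ≤ a * c
  discriminant {n} {a} {c} {h} 0≤a 0≤c 0≤h form ac<nhh =
    form m k (*-nonneg 0≤h 0≤q) (+-nonneg (*-nonneg 0≤a 0≤q) 0≤δ)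
      (+⇒< 0<gap (trans lhs (trans expand (+-congʳ (sym rhs)))))
    where
    δ = proj₁ (<⇒+ ac<nhh)
    0<δ = proj₁ (proj₂ (<⇒+ ac<nhh))
    0≤δ = <⇒≤ 0<δ
    nhh≈ac+δ = proj₂ (proj₂ (<⇒+ ac<nhh))
    -- With `c` in place of `q`, `k` would be n h², the critical point of the form at m = h c. The
    -- shift by one makes the δ² coefficient of `gap` equal to 2q - c = c + 2, positive even for c =
    -- 0.
    q = c + 1#
    0≤q = +-nonneg 0≤c 0≤1
    m = h * q
    k = a * q + δ
    gap = a * (q * q) * δ + (c + 1#) * (δ * δ) + δ * δ
    0<gap : 0# < gap
    0<gap = +-nonneg-pos
      (+-nonneg (*-nonneg (*-nonneg 0≤a (*-nonneg 0≤q 0≤q)) 0≤δ) (*-nonneg 0≤q (*-nonneg 0≤δ 0≤δ)))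
      (0<x*y 0<δ 0<δ)
    lhs : n * (h * m * k + h * m * k) ≈ (a * c + δ) * (q * k + q * k)
    lhs = trans
      (solve 4 (λ n h q k →
        n :* (h :* (h :* q) :* k :+ h :* (h :* q) :* k) := n :* (h :* h) :* (q :* k :+ q :* k))
        refl n h q k)
      (*-congʳ nhh≈ac+δ)
    rhs : n * (m * m * a) + k * k * c ≈ (a * c + δ) * (q * q * a) + k * k * c
    rhs = +-congʳ (trans
      (solve 4 (λ n h q a → n :* (h :* q :* (h :* q) :* a) := n :* (h :* h) :* (q :* q :* a))
        refl n h q a)
      (*-congʳ nhh≈ac+δ))
    expand : (a * c + δ) * (q * k + q * k) ≈ (a * c + δ) * (q * q * a) + k * k * c + gap
    expand = solve 3 (λ a c δ → let q = c :+ con 1; k = a :* q :+ δ in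
      (a :* c :+ δ) :* (q :* k :+ q :* k) :=
      (a :* c :+ δ) :* (q :* q :* a) :+ k :* k :* c
        :+ (a :* (q :* q) :* δ :+ (c :+ con 1) :* (δ :* δ) :+ δ :* δ)) refl a c δ

  -- z = x + δ / (2x + 1 + δ) with δ = y - x².
  x²<y⇒∃z>x,z²≤y : ∀ {x y} → 0# ≤ x → x * x < y → ∃[ z ] x < z × z * z ≤ y
  x²<y⇒∃z>x,z²≤y {x} {y} 0≤x x²<y =
    x + ε , +⇒< 0<ε refl , +⇒≤ 0≤rest (trans y≈x²+δ (trans (+-congˡ δ≈) square))
    where
    δ = proj₁ (<⇒+ x²<y)
    0<δ = proj₁ (proj₂ (<⇒+ x²<y))
    0≤δ = <⇒≤ 0<δ
    y≈x²+δ = proj₂ (proj₂ (<⇒+ x²<y))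
    p = x + x + 1#
    0≤p = +-nonneg (+-nonneg 0≤x 0≤x) 0≤1
    0<p+δ = +-nonneg-pos 0≤p 0<δ
    i = reciprocal (pos⇒#0 0<p+δ)
    0<i = reciprocal-pos (pos⇒#0 0<p+δ) 0<p+δ
    [p+δ]i≈1 : (p + δ) * i ≈ 1#
    [p+δ]i≈1 = reciprocal-inverseʳ (pos⇒#0 0<p+δ)
    ε = δ * i
    0<ε = 0<x*y 0<δ 0<i
    rest = ε * (i * p) + ε * δ
    0≤rest : 0# ≤ rest
    0≤rest = +-nonneg (*-nonneg (<⇒≤ 0<ε) (*-nonneg (<⇒≤ 0<i) 0≤p)) (*-nonneg (<⇒≤ 0<ε) 0≤δ)
    -- Expand δ = ε (p + δ) and rewrite the summand 1 of `p` as (p + δ) i: this produces the ε²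
    -- needed for the square, and `rest` is what remains.
    δ≈ : δ ≈ ε * (x + x) + ε * ((p + δ) * i) + ε * δ
    δ≈ = trans (sym (*-identityʳ δ)) (trans (*-congˡ (sym [p+δ]i≈1))
      (trans (solve 3 (λ x δ i → let p = x :+ x :+ con 1 in
          δ :* ((p :+ δ) :* i) := δ :* i :* (x :+ x) :+ δ :* i :* con 1 :+ δ :* i :* δ) refl x δ i)
        (+-congʳ (+-congˡ (*-congˡ (sym [p+δ]i≈1))))))
    square : x * x + (ε * (x + x) + ε * ((p + δ) * i) + ε * δ) ≈ (x + ε) * (x + ε) + rest
    square = solve 3 (λ x δ i → let p = x :+ x :+ con 1; ε = δ :* i in
      x :* x :+ (ε :* (x :+ x) :+ ε :* ((p :+ δ) :* i) :+ ε :* δ) :=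
      (x :+ ε) :* (x :+ ε) :+ (ε :* (i :* p) :+ ε :* δ)) refl x δ i

-- Inner products and the descent of a shattered tree.

module Perceptron {ℓ} (R : RealNumbers ℓ) (H : HilbertSpace R) where
  open RealNumbers R
  open OrderedField R
  open HilbertSpace H
  open SemiringSolver commutativeSemiring
  open RingProperties ring using (-‿distribˡ-*; -‿distribʳ-*; -‿involutive)
  open Module space using (*ₗ-zeroˡ; ≈ᴹ-refl; ≈ᴹ-sym)

  ⟨0,⟩≈0 : ∀ v → ⟨ 0ᴹ , v ⟩ ≈ 0#
  ⟨0,⟩≈0 v = trans (⟨⟩-cong (≈ᴹ-sym (*ₗ-zeroˡ 0ᴹ)) ≈ᴹ-refl) (trans (⟨⟩-*ˡ 0# 0ᴹ v) (zeroˡ ⟨ 0ᴹ , v ⟩))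

  ⟨⟩-linearˡ : ∀ s e u v → ⟨ s +ᴹ e *ₗ u , v ⟩ ≈ ⟨ s , v ⟩ + e * ⟨ u , v ⟩
  ⟨⟩-linearˡ s e u v = trans (⟨⟩-+ˡ s (e *ₗ u) v) (+-congˡ (⟨⟩-*ˡ e u v))

  ⟨⟩-expand : ∀ s e u →
    ⟨ s +ᴹ e *ₗ u , s +ᴹ e *ₗ u ⟩ ≈ ⟨ s , s ⟩ + (e * ⟨ s , u ⟩ + e * ⟨ s , u ⟩) + e * e * ⟨ u , u ⟩
  ⟨⟩-expand s e u =
    trans (⟨⟩-linearˡ s e u _)
      (trans (+-cong (linearʳ s) (*-congˡ (trans (linearʳ u) (+-congʳ (⟨⟩-sym u s)))))
        (solve 4 (λ ss su uu e → ss :+ e :* su :+ e :* (su :+ e :* uu) :=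
          ss :+ (e :* su :+ e :* su) :+ e :* e :* uu) refl ⟨ s , s ⟩ ⟨ s , u ⟩ ⟨ u , u ⟩ e))
    where
    linearʳ : ∀ t → ⟨ t , s +ᴹ e *ₗ u ⟩ ≈ ⟨ t , s ⟩ + e * ⟨ t , u ⟩
    linearʳ t = trans (⟨⟩-sym t _)
      (trans (⟨⟩-linearˡ s e u t) (+-cong (⟨⟩-sym s t) (*-congˡ (⟨⟩-sym u t))))

  -x*-y≈x*y : ∀ x y → - x * - y ≈ x * y
  -x*-y≈x*y x y = trans (sym (-‿distribˡ-* x (- y)))
    (trans (-‿cong (sym (-‿distribʳ-* x y))) (-‿involutive (x * y)))

  -- Nonnegativity of the squared norm of s - k v. In the solver call - k is an independent variable
  -- `j`; the leftover multiple of k + j vanishes afterwards.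
  2k⟨s,v⟩≤⟨s,s⟩+k²⟨v,v⟩ : ∀ s k v → k * ⟨ s , v ⟩ + k * ⟨ s , v ⟩ ≤ ⟨ s , s ⟩ + k * k * ⟨ v , v ⟩
  2k⟨s,v⟩≤⟨s,s⟩+k²⟨v,v⟩ s k v =
    +⇒≤ (⟨⟩-nonneg (s +ᴹ (- k) *ₗ v)) (sym
      (trans (+-congˡ (⟨⟩-expand s (- k) v))
        (trans (solve 6 (λ k j sv ss jj vv →
            k :* sv :+ k :* sv :+ (ss :+ (j :* sv :+ j :* sv) :+ jj :* vv) :=
            ss :+ jj :* vv :+ (k :+ j) :* (sv :+ sv)) refl
            k (- k) ⟨ s , v ⟩ ⟨ s , s ⟩ (- k * - k) ⟨ v , v ⟩)
          (trans (+-cong (+-congˡ (*-congʳ (-x*-y≈x*y k k))) (trans (*-congʳ (-‿inverseʳ k)) (zeroˡ _)))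
            (+-identityʳ _)))))

  module _ {X Y : Set ℓ} (A : X → Y → ℝ) (u : X → Carrierᴹ) (v : Y → Carrierᴹ)
    (factors : ∀ x y → A x y ≈ ⟨ u x , v y ⟩) (a c α m k : ℝ)
    (‖u‖²≤a : ∀ x → ⟨ u x , u x ⟩ ≤ a) (‖v‖²≤c : ∀ y → ⟨ v y , v y ⟩ ≤ c)
    (0≤m : 0# ≤ m) (0≤k : 0# ≤ k) where

    h : ℝ
    h = α /2

    -- The bound for the subtree of depth d still to be descended from s; the
    -- weights w need not be recorded because each turn absorbs its own.
    Potential : ℕ → Carrierᴹ → Y → Set ℓ
    Potential d s y =
      fromℕ d * (h * m * k + h * m * k) + (k * ⟨ s , v y ⟩ + k * ⟨ s , v y ⟩)
        ≤ ⟨ s , s ⟩ + fromℕ d * (m * m * a) + k * k * c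

    potential-zero : ∀ s y → Potential 0 s y
    potential-zero s y = ≤-resp
      (sym (trans (+-congʳ (zeroˡ _)) (+-identityˡ _)))
      (+-congʳ (sym (trans (+-congˡ (zeroˡ _)) (+-identityʳ _))))
      (≤-trans (2k⟨s,v⟩≤⟨s,s⟩+k²⟨v,v⟩ s k (v y))
        (+-mono-≤ (≤-reflexive refl) (*-monoˡ-≤ (*-nonneg 0≤k 0≤k) (‖v‖²≤c y))))

    -- e = ±m is the signed step length along u x.
    potential-suc : ∀ d {s x w y} e → e * e ≈ m * m →
      e * ⟨ s , u x ⟩ ≤ e * (k * w) →
      e * w + m * h ≤ e * A x y →
      Potential d (s +ᴹ e *ₗ u x) y → Potential (ℕ.suc d) s y
    potential-suc d {s} {x} {w} {y} e e²≈m² choice turn ih =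
      -- Add to the induction hypothesis 2k times `turn`, twice `choice`, and m² times the bound on
      -- `u x`. `Z` collects the terms common to both sides, among them those with the weight `w`.
      +-cancelʳ-≤ Z (≤-resp left≈ right≈
        (+-mono-≤ (+-mono-≤ (+-mono-≤ ih′ (*-monoˡ-≤ (+-nonneg 0≤k 0≤k) turn))
          (+-mono-≤ choice choice))
          (*-monoˡ-≤ (*-nonneg 0≤m 0≤m) (‖u‖²≤a x))))
      where
      N = fromℕ d
      B = A x y
      ss = ⟨ s , s ⟩
      su = ⟨ s , u x ⟩
      sv = ⟨ s , v y ⟩
      uu = ⟨ u x , u x ⟩
      Z = (k + k) * (e * B) + (k + k) * (e * w) + (e * su + e * su) + m * m * uu
      sv′ : ⟨ s +ᴹ e *ₗ u x , v y ⟩ ≈ sv + e * B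
      sv′ = trans (⟨⟩-linearˡ s e (u x) (v y)) (+-congˡ (*-congˡ (sym (factors x y))))
      ih′ : N * (h * m * k + h * m * k) + (k * (sv + e * B) + k * (sv + e * B))
          ≤ ss + (e * su + e * su) + m * m * uu + N * (m * m * a) + k * k * c
      ih′ = ≤-resp
        (+-congˡ (+-cong (*-congˡ sv′) (*-congˡ sv′)))
        (+-congʳ (+-congʳ (trans (⟨⟩-expand s e (u x)) (+-congˡ (*-congʳ e²≈m²)))))
        ih
      left≈ : N * (h * m * k + h * m * k) + (k * (sv + e * B) + k * (sv + e * B))
          + (k + k) * (e * w + m * h) + (e * su + e * su) + m * m * uu
        ≈ (1# + N) * (h * m * k + h * m * k) + (k * sv + k * sv) + Z
      left≈ = solve 10 (λ N h m k sv e B w su uu →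
        N :* (h :* m :* k :+ h :* m :* k) :+ (k :* (sv :+ e :* B) :+ k :* (sv :+ e :* B))
          :+ (k :+ k) :* (e :* w :+ m :* h) :+ (e :* su :+ e :* su) :+ m :* m :* uu
        := (con 1 :+ N) :* (h :* m :* k :+ h :* m :* k) :+ (k :* sv :+ k :* sv)
          :+ ((k :+ k) :* (e :* B) :+ (k :+ k) :* (e :* w) :+ (e :* su :+ e :* su) :+ m :* m :* uu))
        refl N h m k sv e B w su uu
      right≈ : ss + (e * su + e * su) + m * m * uu + N * (m * m * a) + k * k * c
          + (k + k) * (e * B) + (e * (k * w) + e * (k * w)) + m * m * a
        ≈ ss + (1# + N) * (m * m * a) + k * k * c + Z
      right≈ = solve 11 (λ N ss m k a c e B w su uu →
        ss :+ (e :* su :+ e :* su) :+ m :* m :* uu :+ N :* (m :* m :* a) :+ k :* k :* c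
          :+ (k :+ k) :* (e :* B) :+ (e :* (k :* w) :+ e :* (k :* w)) :+ m :* m :* a
        := ss :+ (con 1 :+ N) :* (m :* m :* a) :+ k :* k :* c
          :+ ((k :+ k) :* (e :* B) :+ (k :+ k) :* (e :* w) :+ (e :* su :+ e :* su) :+ m :* m :* uu))
        refl N ss m k a c e B w su uu

    -- The path is chosen from `s` alone, before any column is known, so shattering can later supply
    -- a `y` for it. The double negation is there because the comparison made at each node need not
    -- be decidable.
    descend : ∀ {d} (t : MistakeTree R X d) s →
      ¬ ¬ (∃[ p ] (∀ y → Realizes R A α t p y → Potential d s y))
    descend leaf s no-path = no-path ([] , λ y _ → potential-zero s y)
    descend (node {d} x w l r) s no-path = ¬¬-excluded-middle λ where
        (yes kw<su) → descend r (s +ᴹ (- m) *ₗ u x) λ (p , potential) →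
          no-path (right ∷ p , λ y (A≤w-h , realizes) →
            potential-suc d (- m) (-x*-y≈x*y m m)
              (neg-anti-≤ (<⇒≤ kw<su)) (right-turn A≤w-h) (potential y realizes))
        (no kw≮su) → descend l (s +ᴹ m *ₗ u x) λ (p , potential) →
          no-path (left ∷ p , λ y (w+h≤A , realizes) →
            potential-suc d m refl (*-monoˡ-≤ 0≤m kw≮su)
              (≤-resp (distribˡ m w h) refl (*-monoˡ-≤ 0≤m w+h≤A)) (potential y realizes))
      where
      neg-anti-≤ : ∀ {p q} → p ≤ q → - m * q ≤ - m * p
      -- Adding m p + m q to both sides reduces the claim to m p ≤ m q.
      neg-anti-≤ {p} {q} p≤q = +-cancelʳ-≤ (m * p + m * q) (≤-resp
        (sym (cancel q (m * p) (+-comm (m * p) (m * q))))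
        (sym (cancel p (m * q) refl)) (*-monoˡ-≤ 0≤m p≤q))
        where
        cancel : ∀ t o {z} → z ≈ m * t + o → - m * t + z ≈ o
        cancel t o z≈ = trans (+-congˡ z≈) (trans (sym (+-assoc (- m * t) (m * t) o))
          (trans (+-congʳ (trans (sym (distribʳ t (- m) m))
            (trans (*-congʳ (-‿inverseˡ m)) (zeroˡ t)))) (+-identityˡ o)))
      right-turn : ∀ {B} → B ≤ w - h → - m * w + m * h ≤ - m * B
      right-turn {B} B≤w-h = ≤-resp
        (trans (distribˡ (- m) w (- h)) (+-congˡ (-x*-y≈x*y m h))) refl (neg-anti-≤ B≤w-h)

-- From factorizations to the norm and the dimension.

module _ {ℓ} (R : RealNumbers ℓ) where
  open RealNumbers R
  open OrderedField R
  open SemiringSolver commutativeSemiring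

  module _ {X Y : Set ℓ} (A : X → Y → ℝ) (α : ℝ) (0<α : 0# < α) where

    shattered⇒d[α/2]²≤cost² : ∀ (F : Factorization R A) {d} (t : MistakeTree R X d) →
      Shatters R A α t →
      let open Factorization F in fromℕ d * (α /2 * α /2) ≤ cost * cost
    shattered⇒d[α/2]²≤cost² F {d} t shatters =
      ≤-resp refl
        (solve 2 (λ U V → U :* U :* (V :* V) := U :* V :* (U :* V)) refl supᵘ supᵛ)
        (discriminant (*-nonneg 0≤supᵘ 0≤supᵘ) (*-nonneg 0≤supᵛ 0≤supᵛ) (0≤x/2 (<⇒≤ 0<α)) form)
      where
      open Factorization F
      open HilbertSpace H
      open Perceptron R H
      0≤supᵘ = proj₁ isSupᵘ
      0≤supᵛ = proj₁ isSupᵛ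
      ⟨⟩≤ : ∀ {b} z → ‖ z ‖ ≤ b → ⟨ z , z ⟩ ≤ b * b
      ⟨⟩≤ z ‖z‖≤b = ≤-resp (‖‖-square z) refl
        (*-mono-≤ (‖‖-nonneg z) (≤-trans (‖‖-nonneg z) ‖z‖≤b) ‖z‖≤b ‖z‖≤b)
      form : ∀ m k → 0# ≤ m → 0# ≤ k →
        fromℕ d * (α /2 * m * k + α /2 * m * k)
          ≤ fromℕ d * (m * m * (supᵘ * supᵘ)) + k * k * (supᵛ * supᵛ)
      -- The inequality is a negation, so assuming it `violated` discharges the double negation of
      -- `descend`.
      form m k 0≤m 0≤k violated =
        descend A u v factors (supᵘ * supᵘ) (supᵛ * supᵛ) α m k
          (λ x → ⟨⟩≤ (u x) (proj₁ (proj₂ isSupᵘ) x))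
          (λ y → ⟨⟩≤ (v y) (proj₁ (proj₂ isSupᵛ) y))
          0≤m 0≤k t 0ᴹ
          λ (p , potential) → let y , realizes = shatters p in
            -- The descent starts at `0ᴹ`, so the terms in `s` vanish and the potential becomes the
            -- quadratic form.
            ≤-resp
              (trans (+-congˡ (trans (+-cong (k⟨0,v⟩≈0 y) (k⟨0,v⟩≈0 y)) (+-identityʳ 0#))) (+-identityʳ _))
              (+-congʳ (trans (+-congʳ (⟨0,⟩≈0 0ᴹ)) (+-identityˡ _)))
              (potential y realizes) violated
        where
        k⟨0,v⟩≈0 : ∀ y → k * ⟨ 0ᴹ , v y ⟩ ≈ 0#
        k⟨0,v⟩≈0 y = trans (*-congˡ (⟨0,⟩≈0 (v y))) (zeroʳ k)

    module _ (g : ℝ) (isNorm : IsFactorizationNorm R A [ g ]) where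

      0≤cost : ∀ (F : Factorization R A) → 0# ≤ Factorization.cost F
      0≤cost F = *-nonneg (proj₁ isSupᵘ) (proj₁ isSupᵛ)
        where open Factorization F

      0≤norm : 0# ≤ g
      0≤norm = [≤]-injective _≤_ (proj₂ isNorm [ 0# ] (λ F → [ 0≤cost F ]))

      -- If g² < x, some z > g has z² ≤ x. No cost lies below z, as its square would then be less
      -- than x; so z is a lower bound exceeding the greatest one.
      x≤cost²⇒x≤norm² : ∀ {x} →
        (∀ (F : Factorization R A) → let open Factorization F in x ≤ cost * cost) → x ≤ g * g
      x≤cost²⇒x≤norm² x≤cost² g²<x =
        let z , g<z , z²≤x = x²<y⇒∃z>x,z²≤y 0≤norm g²<x
            z≤cost = λ F cost<z → ≤-trans z²≤x (x≤cost² F) (x<y⇒x²<y² (0≤cost F) cost<z)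
        in [≤]-injective _≤_ (proj₂ isNorm [ z ] (λ F → [ z≤cost F ])) g<z

      α²#0 = pos⇒#0 (0<x*y 0<α 0<α)
      1/α² = reciprocal α²#0

      bound : ℝ
      bound = fromℕ 4 * (g * g) / (α * α) [ α²#0 ]

      0≤1/α² : 0# ≤ 1/α²
      0≤1/α² = <⇒≤ (reciprocal-pos α²#0 (0<x*y 0<α 0<α))

      0≤bound : 0# ≤ bound
      0≤bound = *-nonneg (*-nonneg (0≤fromℕ 4) (*-nonneg 0≤norm 0≤norm)) 0≤1/α²

      -- Multiply d (α/2)² ≤ g² by 4/α².
      shattered⇒depth≤bound : ∀ {d} (t : MistakeTree R X d) → Shatters R A α t → fromℕ d ≤ bound
      shattered⇒depth≤bound {d} t shatters = ≤-resp
        (trans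
          (solve 3 (λ N h i → let 4# = con 1 :+ (con 1 :+ (con 1 :+ (con 1 :+ con 0))) in
            4# :* i :* (N :* (h :* h)) := N :* ((h :+ h) :* (h :+ h) :* i)) refl (fromℕ d) (α /2) 1/α²)
          (trans (*-congˡ (trans (*-congʳ (*-cong (x/2+x/2≈x α) (x/2+x/2≈x α)))
            (reciprocal-inverseʳ α²#0))) (*-identityʳ _)))
        (solve 3 (λ f i g → f :* i :* (g :* g) := f :* (g :* g) :* i) refl (fromℕ 4) 1/α² g)
        (*-monoˡ-≤ (*-nonneg (0≤fromℕ 4) 0≤1/α²)
          (x≤cost²⇒x≤norm² (λ F → shattered⇒d[α/2]²≤cost² F t shatters)))

      bound<⇒depth< : ∀ {n d} → bound < fromℕ n →
        (t : MistakeTree R X d) → Shatters R A α t → d ℕ.< n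
      bound<⇒depth< bound<n t shatters = ℕₚ.≰⇒> λ n≤d →
        ≤-trans (fromℕ-mono-≤ n≤d) (shattered⇒depth≤bound t shatters) bound<n

      Ldim≤bound : ∀ L → IsLdim R A α L → fromℕ∞ R L ≤∞ [ bound ]
      Ldim≤bound [ ℕ.zero ] isLdim = [ 0≤bound ]
      -- If the bound were below n + 1, all shattered depths would be at most n, contradicting that
      -- n + 1 is their least upper bound.
      Ldim≤bound [ ℕ.suc n ] isLdim = [ (λ bound<1+n → ℕₚ.1+n≰n
        ([≤]-injective ℕ._≤_ (proj₂ isLdim [ n ] λ t shatters →
          [ ℕ.s≤s⁻¹ (bound<⇒depth< bound<1+n t shatters) ]))) ]
      -- An Archimedean `n` above the bound is a finite upper bound for all depths, so their
      -- supremum cannot be infinite.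
      Ldim≤bound ⊤⁺ isLdim = ⊥-elim (∞≰n (proj₂ isLdim [ n ] λ t shatters →
          [ ℕₚ.<⇒≤ (bound<⇒depth< (proj₂ (archimedean bound)) t shatters) ]))
        where
        n = proj₁ (archimedean bound)
        ∞≰n : ∀ {n} → ¬ (_≤⁺_ ℕ._≤_ ⊤⁺ [ n ])
        ∞≰n ()

theorem4p1 : ∀ {ℓ} (R : RealNumbers ℓ) → let open RealNumbers R in
    ∀ {X Y : Set ℓ} (A : X → Y → ℝ) (α : ℝ) (0<α : 0# < α) →
    ∀ (L : ℕ ⁺) → IsLdim R A α L →
    ∀ (γ : ℝ ⁺) → IsFactorizationNorm R A γ →
    fromℕ∞ R L ≤∞ 4γ²/α² R γ α 0<α
theorem4p1 R A α 0<α L isLdim ⊤⁺ isNorm = fromℕ∞ R L ≤⊤⁺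
theorem4p1 R A α 0<α L isLdim [ g ] isNorm = Ldim≤bound R A α 0<α g isNorm L isLdim
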